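{- For every $\epsilon>0$, every connected graph admits a proper straight-line drawing with spanning ratio smaller than $1+\epsilon$.
   Context: A straight-line drawing maps vertices to distinct points of the plane and edges to straight-line segments between their end-vertices; it is proper if no edge contains a vertex other than its end-vertices. In a straight-line drawing $\Gamma$, $\pi_\Gamma(u,v)$ is the minimum total Euclidean length of a path between $u$ and $v$, $\|uv\|_\Gamma$ is their Euclidean distance, and the spanning ratio is $\max_{u\neq v}\pi_\Gamma(u,v)/\|uv\|_\Gamma$. -}

module Defs where

open import Data.Empty using (⊥-elim)
open import Data.Fin.Base using (Fin; zero; suc)
import Data.Fin.Base as Fin
import Data.Fin.Properties as Fin
open import Data.Integer.Base as ℤ using (+_)
import Data.Integer.Properties as ℤ
open import Data.List.Base using (List; []; _∷_; head; last; length; lookup; map; foldr; concatMap; filter; allFin; upTo; cartesianProductWith)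
open import Data.List.Membership.Propositional using (_∈_; lose)
open import Data.List.Membership.Propositional.Properties using (∈-filter⁺; ∈-concatMap⁺; ∈-upTo⁺; ∈-cartesianProductWith⁺; ∈-allFin; ∈-lookup)
import Data.List.Relation.Unary.All as All
open import Data.List.Relation.Unary.AllPairs using ([]; _∷_)
open import Data.List.Relation.Unary.Any using (here)
open import Data.List.Relation.Unary.Linked using (Linked; linked?)
open import Data.List.Relation.Unary.Unique.Propositional using (Unique)
import Data.List.Relation.Unary.Unique.DecPropositional as UniqueDec
open import Data.Maybe.Base using (just)
open import Data.Maybe.Properties using (≡-dec)
open import Data.Nat.Base as ℕ using (ℕ; zero; suc)
import Data.Nat.Properties as ℕ
import Data.Nat.Coprimality as Coprimality
open import Data.Product.Base using (Σ-syntax; ∃-syntax; _×_; _,_; proj₁; proj₂)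
open import Data.Rational.Base
open import Data.Rational.Properties
open import Data.Rational.Solver using (module +-*-Solver)
open import Data.Sum.Base using (_⊎_; inj₁; inj₂)
open import Level using (0ℓ)
open import Relation.Binary.Core using (Rel)
open import Relation.Binary.Definitions using (Decidable; Symmetric)
open import Relation.Binary.PropositionalEquality using (_≡_; _≢_; refl; sym; trans; cong; subst; subst₂; module ≡-Reasoning)
open import Relation.Nullary using (¬_; Dec; yes; no)
open import Relation.Nullary.Decidable using (_×-dec_)

open +-*-Solver using (solve; _:=_; con; _:+_; _:*_; _:-_; :-_)

0<½* : ∀ {ε} → 0ℚ < ε → 0ℚ < ½ * ε
0<½* {ε} p = subst (_< ½ * ε) (*-zeroʳ ½) (*-monoʳ-<-pos ½ p)

½+½ : ∀ ε → ½ * ε + ½ * ε ≡ ε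
½+½ = solve 1 (λ e → con ½ :* e :+ con ½ :* e := e) refl

0<* : ∀ {p q} → 0ℚ < p → 0ℚ < q → 0ℚ < p * q
0<* {p} {q} 0<p 0<q = subst (_< p * q) (*-zeroʳ p) (*-monoʳ-<-pos p {{positive 0<p}} 0<q)

0≤* : ∀ {p q} → 0ℚ ≤ p → 0ℚ ≤ q → 0ℚ ≤ p * q
0≤* {p} {q} 0≤p 0≤q = subst (_≤ p * q) (*-zeroʳ p) (*-monoˡ-≤-nonNeg p {{nonNegative 0≤p}} 0≤q)

0≤+ : ∀ {p q} → 0ℚ ≤ p → 0ℚ ≤ q → 0ℚ ≤ p + q
0≤+ = +-mono-≤

p≤p+q : ∀ p {q} → 0ℚ ≤ q → p ≤ p + q
p≤p+q p {q} 0≤q = subst (_≤ p + q) (+-identityʳ p) (+-monoʳ-≤ p 0≤q)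

square-mono-≤ : ∀ {p q} → 0ℚ ≤ p → p ≤ q → p * p ≤ q * q
square-mono-≤ {p} {q} 0≤p p≤q = ≤-trans
  (*-monoˡ-≤-nonNeg p {{nonNegative 0≤p}} p≤q)
  (*-monoʳ-≤-nonNeg q {{nonNegative (≤-trans 0≤p p≤q)}} p≤q)

p≤∣p∣ : ∀ p → p ≤ ∣ p ∣
p≤∣p∣ p with ≤-total 0ℚ p
... | inj₁ 0≤p = ≤-reflexive (sym (0≤p⇒∣p∣≡p 0≤p))
... | inj₂ p≤0 = ≤-trans p≤0 (0≤∣p∣ p)

∣p-q∣≡∣q-p∣ : ∀ p q → ∣ p - q ∣ ≡ ∣ q - p ∣
∣p-q∣≡∣q-p∣ p q = trans (sym (∣-p∣≡∣p∣ (p - q)))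
  (cong ∣_∣ (solve 2 (λ a b → :- (a :- b) := b :- a) refl p q))

near⇒< : ∀ {p q ε} → ∣ p - q ∣ < ε → p < q + ε
near⇒< {p} {q} {ε} h = subst (_< q + ε)
  (solve 2 (λ a b → b :+ (a :- b) := a) refl p q)
  (+-monoʳ-< q (≤-<-trans (p≤∣p∣ (p - q)) h))

near⇒> : ∀ {p q ε} → ∣ p - q ∣ < ε → q < p + ε
near⇒> {p} {q} {ε} h = near⇒< (subst (_< ε) (∣p-q∣≡∣q-p∣ p q) h)

<⇒diff< : ∀ {p q ε} → p < q + ε → p - q < ε
<⇒diff< {p} {q} {ε} h = subst (p - q <_)
  (solve 2 (λ b e → (b :+ e) :- b := e) refl q ε) (+-monoˡ-< (- q) h)

<⇒near : ∀ {p q ε} → p < q + ε → q < p + ε → ∣ p - q ∣ < ε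
<⇒near {p} {q} {ε} h k with ∣p∣≡p∨∣p∣≡-p (p - q)
... | inj₁ e = subst (_< ε) (sym e) (<⇒diff< h)
... | inj₂ e = subst (_< ε)
      (sym (trans e (solve 2 (λ a b → :- (a :- b) := b :- a) refl p q)))
      (<⇒diff< k)

ι : ℕ → ℚ
ι n = mkℚ (+ n) 0 (Coprimality.sym (Coprimality.1-coprimeTo n))

ι≡/1 : ∀ n → + n / 1 ≡ ι n
ι≡/1 n = normalize-coprime (Coprimality.sym (Coprimality.1-coprimeTo n))

ι-suc : ∀ n → ι (suc n) ≡ ι n + 1ℚ
ι-suc n = sym (trans
  (cong (λ i → i / 1) {x = (+ n) ℤ.* + 1 ℤ.+ + 1 ℤ.* + 1} {y = + suc n}
     (trans (cong (ℤ._+ + 1) (ℤ.*-identityʳ (+ n))) (cong +_ (ℕ.+-comm n 1))))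
  (ι≡/1 (suc n)))

ι-mono-≤ : ∀ {m n} → m ℕ.≤ n → ι m ≤ ι n
ι-mono-≤ {m} {n} h = *≤* (subst₂ ℤ._≤_ (sym (ℤ.*-identityʳ (+ m))) (sym (ℤ.*-identityʳ (+ n))) (ℤ.+≤+ h))

archimedean : ∀ p → p ≤ ι ℤ.∣ ↥ p ∣
archimedean p = ≤-trans (p≤∣p∣ p) (lemma p)
  where
  lemma : ∀ p → ∣ p ∣ ≤ ι ℤ.∣ ↥ p ∣
  lemma (mkℚ i d c) = *≤* (subst₂ ℤ._≤_ (ℤ.pos-* ℤ.∣ i ∣ 1) (ℤ.pos-* ℤ.∣ i ∣ (suc d))
    (ℤ.+≤+ (ℕ.*-monoʳ-≤ ℤ.∣ i ∣ (ℕ.s≤s ℕ.z≤n))))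

1/suc : ℕ → ℚ
1/suc k = + 1 / suc k

1/suc-inverse : ∀ k → ι (suc k) * 1/suc k ≡ 1ℚ
1/suc-inverse k = trans
  (cong (ι (suc k) *_) (normalize-coprime (Coprimality.1-coprimeTo (suc k))))
  (*-inverseʳ (ι (suc k)))

0<1/suc : ∀ k → 0ℚ < 1/suc k
0<1/suc k = positive⁻¹ (1/suc k) {{normalize-pos 1 (suc k)}}

0<ι-suc : ∀ k → 0ℚ < ι (suc k)
0<ι-suc k = positive⁻¹ (ι (suc k))

1/suc-small : ∀ {ε} → 0ℚ < ε → ∃[ N ] (∀ k → N ℕ.≤ k → 1/suc k ≤ ε)
1/suc-small {ε} 0<ε = N , λ k N≤k →
  *-cancelˡ-≤-pos (ι (suc k)) {{positive (0<ι-suc k)}}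
    (subst₂ _≤_ (trans (*-inverseˡ ε) (sym (1/suc-inverse k))) refl
      (*-monoʳ-≤-nonNeg ε {{nonNegative (<⇒≤ 0<ε)}}
        (≤-trans (archimedean (1/ ε)) (ι-mono-≤ (ℕ.≤-trans N≤k (ℕ.n≤1+n k))))))
  where
  instance
    ε≢0 : NonZero ε
    ε≢0 = >-nonZero 0<ε
  N = ℤ.∣ ↥ (1/ ε) ∣

-- For δ > 0 and q ≥ 0, the largest multiple jδ with j ≤ fuel and (jδ)² ≤ q.
climb : (δ q : ℚ) (fuel : ℕ) → ℚ
climb δ q zero       = 0ℚ
climb δ q (suc fuel) with climb δ q fuel
... | s with (s + δ) * (s + δ) ≤? q
...   | yes _ = s + δ
...   | no  _ = s

-- For q ≥ 0 this is the largest multiple s of δ = 1/(k+1) with s² ≤ q, so that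
-- s² ≤ q < (s + δ)² (see √-lower and √-upper); the fuel exceeds (q + 1)/δ.
√ℚ : ℕ → ℚ → ℚ
√ℚ k q = climb (1/suc k) q (suc ℤ.∣ ↥ (ι (suc k) * (q + 1ℚ)) ∣)

climb-lower : ∀ {δ q} → 0ℚ < δ → 0ℚ ≤ q → ∀ n →
              0ℚ ≤ climb δ q n × climb δ q n * climb δ q n ≤ q
climb-lower 0<δ 0≤q zero = ≤-refl , 0≤q
climb-lower {δ} {q} 0<δ 0≤q (suc n) with climb δ q n | climb-lower {δ} {q} 0<δ 0≤q n
... | s | 0≤s , s²≤q with (s + δ) * (s + δ) ≤? q
...   | yes h = 0≤+ 0≤s (<⇒≤ 0<δ) , h
...   | no  _ = 0≤s , s²≤q

climb-upper : ∀ δ q n → climb δ q n ≡ ι n * δ ⊎ q < (climb δ q n + δ) * (climb δ q n + δ)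
climb-upper δ q zero = inj₁ (sym (*-zeroˡ δ))
climb-upper δ q (suc n) with climb δ q n | climb-upper δ q n
... | s | ih with (s + δ) * (s + δ) ≤? q
...   | no h = inj₂ (≰⇒> h)
...   | yes h with ih
...     | inj₁ e = inj₁ (trans (cong (_+ δ) e) (trans
            (solve 2 (λ a d → a :* d :+ d := (a :+ con 1ℚ) :* d) refl (ι n) δ)
            (cong (_* δ) (sym (ι-suc n)))))
...     | inj₂ u = ⊥-elim (<-irrefl refl (<-≤-trans u h))

q<[q+1]² : ∀ {q} → 0ℚ ≤ q → q < (q + 1ℚ) * (q + 1ℚ)
q<[q+1]² {q} 0≤q = ≤-<-trans (p≤p+q q 0≤r) (subst (q + r <_) eq q+r<)
  where
  r = q * q + q
  0≤r : 0ℚ ≤ r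
  0≤r = 0≤+ (0≤* 0≤q 0≤q) 0≤q
  q+r< : q + r < q + r + 1ℚ
  q+r< = subst (_< q + r + 1ℚ) (+-identityʳ (q + r)) (+-monoʳ-< (q + r) (positive⁻¹ 1ℚ))
  eq : q + r + 1ℚ ≡ (q + 1ℚ) * (q + 1ℚ)
  eq = solve 1 (λ a → a :+ (a :* a :+ a) :+ con 1ℚ := (a :+ con 1ℚ) :* (a :+ con 1ℚ)) refl q

q<s² : ∀ {q s} → 0ℚ ≤ q → q + 1ℚ ≤ s → q < s * s
q<s² {q} {s} 0≤q q+1≤s = <-≤-trans (q<[q+1]² {q} 0≤q)
  (square-mono-≤ {q + 1ℚ} {s} (0≤+ {q} {1ℚ} 0≤q (<⇒≤ (positive⁻¹ 1ℚ))) q+1≤s)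

climb-exact : ∀ {δ q} n → 0ℚ < δ → 0ℚ ≤ q → q + 1ℚ ≤ ι n * δ →
              q < (climb δ q n + δ) * (climb δ q n + δ)
climb-exact {δ} {q} n 0<δ 0≤q big with climb δ q n | climb-upper δ q n | climb-lower {δ} {q} 0<δ 0≤q n
... | s | inj₂ u | _ = u
... | s | inj₁ e | _ , s²≤q =
  ⊥-elim (<-irrefl refl (<-≤-trans (q<s² {q} {s} 0≤q (subst (q + 1ℚ ≤_) (sym e) big)) s²≤q))

√-nonneg : ∀ k {q} → 0ℚ ≤ q → 0ℚ ≤ √ℚ k q
√-nonneg k {q} 0≤q = proj₁ (climb-lower (0<1/suc k) 0≤q (suc ℤ.∣ ↥ (ι (suc k) * (q + 1ℚ)) ∣))

√-lower : ∀ k {q} → 0ℚ ≤ q → √ℚ k q * √ℚ k q ≤ q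
√-lower k {q} 0≤q = proj₂ (climb-lower (0<1/suc k) 0≤q (suc ℤ.∣ ↥ (ι (suc k) * (q + 1ℚ)) ∣))

√-upper : ∀ k {q} → 0ℚ ≤ q → q < (√ℚ k q + 1/suc k) * (√ℚ k q + 1/suc k)
√-upper k {q} 0≤q = climb-exact {1/suc k} {q} (suc J) (0<1/suc k) 0≤q (subst (_≤ ι (suc J) * 1/suc k)
    (trans (solve 3 (λ a b c → (a :* b) :* c := (a :* c) :* b) refl (ι (suc k)) (q + 1ℚ) (1/suc k))
      (trans (cong (_* (q + 1ℚ)) (1/suc-inverse k)) (*-identityˡ (q + 1ℚ))))
    (*-monoʳ-≤-nonNeg (1/suc k) {{nonNegative (<⇒≤ (0<1/suc k))}}
      (≤-trans (archimedean (ι (suc k) * (q + 1ℚ))) (ι-mono-≤ (ℕ.n≤1+n J)))))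
  where
  J = ℤ.∣ ↥ (ι (suc k) * (q + 1ℚ)) ∣

-- √a ≤ √b + ε, in terms of approximations s of √a and t of √b.
√-near : ∀ {h s t a b e} → 0ℚ < h → 0ℚ ≤ t → 0ℚ < e → e ≤ h →
         s * s ≤ a → b < (t + e) * (t + e) → a < b + h * h → s < t + (h + h)
√-near {h} {s} {t} {a} {b} {e} 0<h 0≤t 0<e e≤h s²≤a b<t² a<b with s <? t + (h + h)
... | yes p = p
... | no ¬p = ⊥-elim (<-irrefl refl (<-≤-trans s²< ≤s²))
  where
  0≤h = <⇒≤ 0<h
  s²< : s * s < (t + h) * (t + h) + h * h
  s²< = ≤-<-trans s²≤a (<-trans a<b (+-monoˡ-< (h * h)
    (<-≤-trans b<t² (square-mono-≤ (0≤+ 0≤t (<⇒≤ 0<e)) (+-monoʳ-≤ t e≤h)))))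
  ≤s² : (t + h) * (t + h) + h * h ≤ s * s
  ≤s² = ≤-trans
    (subst ((t + h) * (t + h) + h * h ≤_)
      (solve 2 (λ t h → ((t :+ h) :* (t :+ h) :+ h :* h) :+ (h :* (t :+ h) :+ h :* (t :+ h))
                        := (t :+ (h :+ h)) :* (t :+ (h :+ h))) refl t h)
      (p≤p+q ((t + h) * (t + h) + h * h) (0≤+ (0≤* 0≤h (0≤+ 0≤t 0≤h)) (0≤* 0≤h (0≤+ 0≤t 0≤h)))))
    (square-mono-≤ (0≤+ 0≤t (0≤+ 0≤h 0≤h)) (≮⇒≥ ¬p))

-- Reals are Cauchy sequences of rationals, up to the setoid equality _≈ℝ_ below.
IsCauchy : (ℕ → ℚ) → Set
IsCauchy x = ∀ ε → 0ℚ < ε → ∃[ N ] (∀ m n → N ℕ.≤ m → N ℕ.≤ n → ∣ x m - x n ∣ < ε)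

record ℝ : Set where
  constructor mkℝ
  field
    seq    : ℕ → ℚ
    cauchy : IsCauchy seq

open ℝ public

infix 4 _<ℝ_ _≤ℝ_ _≈ℝ_ _#ℝ_

_<ℝ_ : Rel ℝ 0ℓ
x <ℝ y = ∃[ δ ] (0ℚ < δ × ∃[ N ] (∀ n → N ℕ.≤ n → seq x n + δ ≤ seq y n))

_≤ℝ_ : Rel ℝ 0ℓ
x ≤ℝ y = ∀ ε → 0ℚ < ε → ∃[ N ] (∀ n → N ℕ.≤ n → seq x n ≤ seq y n + ε)

_≈ℝ_ : Rel ℝ 0ℓ
x ≈ℝ y = ∀ ε → 0ℚ < ε → ∃[ N ] (∀ n → N ℕ.≤ n → ∣ seq x n - seq y n ∣ ≤ ε)

-- Apartness: the positive form of x ≠ y, classically equivalent to ¬ (x ≈ℝ y).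
_#ℝ_ : Rel ℝ 0ℓ
x #ℝ y = x <ℝ y ⊎ y <ℝ x

fromℚ : ℚ → ℝ
fromℚ q = mkℝ (λ _ → q) λ ε 0<ε → 0 , λ _ _ _ _ →
  subst (_< ε) (sym (cong ∣_∣ (+-inverseʳ q))) 0<ε

0ℝ 1ℝ : ℝ
0ℝ = fromℚ 0ℚ
1ℝ = fromℚ 1ℚ

lift-cauchy : ∀ (x y : ℝ) (z : ℕ → ℚ) →
  (∀ ε → 0ℚ < ε → ∃[ η ] (0ℚ < η × ∃[ M ] (∀ m n → M ℕ.≤ m → M ℕ.≤ n →
     ∣ seq x m - seq x n ∣ < η → ∣ seq y m - seq y n ∣ < η → ∣ z m - z n ∣ < ε))) →
  IsCauchy z
lift-cauchy x y z H ε 0<ε =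
  let η , 0<η , M , h = H ε 0<ε
      N₁ , h₁ = cauchy x η 0<η
      N₂ , h₂ = cauchy y η 0<η
      a≤ = ℕ.m≤m⊔n M (N₁ ℕ.⊔ N₂)
      b≤ = ℕ.≤-trans (ℕ.m≤m⊔n N₁ N₂) (ℕ.m≤n⊔m M (N₁ ℕ.⊔ N₂))
      c≤ = ℕ.≤-trans (ℕ.m≤n⊔m N₁ N₂) (ℕ.m≤n⊔m M (N₁ ℕ.⊔ N₂))
  in M ℕ.⊔ (N₁ ℕ.⊔ N₂) , λ m n p q →
     h m n (ℕ.≤-trans a≤ p) (ℕ.≤-trans a≤ q)
       (h₁ m n (ℕ.≤-trans b≤ p) (ℕ.≤-trans b≤ q))
       (h₂ m n (ℕ.≤-trans c≤ p) (ℕ.≤-trans c≤ q))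

infixl 6 _+ℝ_ _-ℝ_ _⊔ℝ_
infixl 7 _*ℝ_ _⊓ℝ_
infix  8 -ℝ_

+-near : ∀ a b c d ε → ∣ a - c ∣ < ½ * ε → ∣ b - d ∣ < ½ * ε → ∣ (a + b) - (c + d) ∣ < ε
+-near a b c d ε h k = ≤-<-trans {_} {∣ a - c ∣ + ∣ b - d ∣}
  (subst (λ z → ∣ z ∣ ≤ ∣ a - c ∣ + ∣ b - d ∣) eq (∣p+q∣≤∣p∣+∣q∣ (a - c) (b - d)))
  (subst (∣ a - c ∣ + ∣ b - d ∣ <_) (½+½ ε) (+-mono-< h k))
  where
  eq : (a - c) + (b - d) ≡ (a + b) - (c + d)
  eq = solve 4 (λ a b c d → (a :- c) :+ (b :- d) := (a :+ b) :- (c :+ d)) refl a b c d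

_+ℝ_ : ℝ → ℝ → ℝ
x +ℝ y = mkℝ z (lift-cauchy x y z λ ε 0<ε →
  ½ * ε , 0<½* 0<ε , 0 , λ m n _ _ → +-near (seq x m) (seq y m) (seq x n) (seq y n) ε)
  where
  z : ℕ → ℚ
  z n = seq x n + seq y n

-‿near : ∀ a b ε → ∣ a - b ∣ < ε → ∣ - a - - b ∣ < ε
-‿near a b ε h = subst (_< ε) (trans (sym (∣-p∣≡∣p∣ (a - b))) (cong ∣_∣ eq)) h
  where
  eq : - (a - b) ≡ - a - - b
  eq = solve 2 (λ a b → :- (a :- b) := (:- a) :- (:- b)) refl a b

-ℝ_ : ℝ → ℝ
-ℝ x = mkℝ z (lift-cauchy x x z λ ε 0<ε →
  ε , 0<ε , 0 , λ m n _ _ h _ → -‿near (seq x m) (seq x n) ε h)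
  where
  z : ℕ → ℚ
  z n = - seq x n

_-ℝ_ : ℝ → ℝ → ℝ
x -ℝ y = x +ℝ (-ℝ y)

bounded : ∀ x → ∃[ K ] (0ℚ < K × ∃[ N ] (∀ n → N ℕ.≤ n → ∣ seq x n ∣ ≤ K))
bounded x =
  let N , h = cauchy x 1ℚ (positive⁻¹ 1ℚ)
      a = seq x N
  in ∣ a ∣ + 1ℚ , +-mono-≤-< (0≤∣p∣ a) (positive⁻¹ 1ℚ) , N , λ n N≤n →
     let b = seq x n in
     ≤-trans
       (subst (λ p → ∣ p ∣ ≤ ∣ a ∣ + ∣ b - a ∣) (solve 2 (λ a b → a :+ (b :- a) := b) refl a b)
         (∣p+q∣≤∣p∣+∣q∣ a (b - a)))
       (+-monoʳ-≤ ∣ a ∣ (<⇒≤ (h n N N≤n ℕ.≤-refl)))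

*-near : ∀ {a b c d K L η} → 0ℚ < K → 0ℚ < L → ∣ a ∣ ≤ K → ∣ d ∣ ≤ L →
         ∣ a - c ∣ < η → ∣ b - d ∣ < η → ∣ a * b - c * d ∣ < (K + L) * η
*-near {a} {b} {c} {d} {K} {L} {η} 0<K 0<L ∣a∣≤K ∣d∣≤L h k = ≤-<-trans
  (subst₂ _≤_
    (cong ∣_∣ (solve 4 (λ a b c d → a :* (b :- d) :+ (a :- c) :* d := a :* b :- c :* d) refl a b c d))
    refl
    (∣p+q∣≤∣p∣+∣q∣ (a * (b - d)) ((a - c) * d)))
  (subst₂ _<_ refl
    (solve 3 (λ k l e → k :* e :+ e :* l := (k :+ l) :* e) refl K L η)
    (+-mono-<
      (subst (_< K * η) (sym (∣p*q∣≡∣p∣*∣q∣ a (b - d)))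
        (≤-<-trans (*-monoʳ-≤-nonNeg ∣ b - d ∣ {{∣-∣-nonNeg (b - d)}} ∣a∣≤K)
          (*-monoʳ-<-pos K {{positive 0<K}} k)))
      (subst (_< η * L) (sym (∣p*q∣≡∣p∣*∣q∣ (a - c) d))
        (≤-<-trans (*-monoˡ-≤-nonNeg ∣ a - c ∣ {{∣-∣-nonNeg (a - c)}} ∣d∣≤L)
          (*-monoˡ-<-pos L {{positive 0<L}} h)))))

0<1/ : ∀ {p} (0<p : 0ℚ < p) → 0ℚ < (1/ p) {{>-nonZero 0<p}}
0<1/ {p} 0<p = positive⁻¹ _ {{1/pos⇒pos p {{positive 0<p}}}}

p*[1/p*q]≡q : ∀ p (0<p : 0ℚ < p) q → p * ((1/ p) {{>-nonZero 0<p}} * q) ≡ q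
p*[1/p*q]≡q p 0<p q = trans (sym (*-assoc p _ q))
  (trans (cong (_* q) (*-inverseʳ p {{>-nonZero 0<p}})) (*-identityˡ q))

_*ℝ_ : ℝ → ℝ → ℝ
x *ℝ y = mkℝ z (lift-cauchy x y z λ ε 0<ε →
  let K , 0<K , M₁ , hK = bounded x
      L , 0<L , M₂ , hL = bounded y
      0<KL = +-mono-< 0<K 0<L
      η = (1/ (K + L)) {{>-nonZero 0<KL}} * ε
  in η , 0<* (0<1/ 0<KL) 0<ε , M₁ ℕ.⊔ M₂ , λ m n p q h k →
     subst (∣ z m - z n ∣ <_) (p*[1/p*q]≡q (K + L) 0<KL ε)
       (*-near {seq x m} {seq y m} {seq x n} {seq y n} {K} {L} {η} 0<K 0<L
         (hK m (ℕ.≤-trans (ℕ.m≤m⊔n M₁ M₂) p)) (hL n (ℕ.≤-trans (ℕ.m≤n⊔m M₁ M₂) q)) h k))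
  where
  z : ℕ → ℚ
  z n = seq x n * seq y n

⊔-below : ∀ {a b c d ε} → a < c + ε → b < d + ε → a ⊔ b < (c ⊔ d) + ε
⊔-below {a} {b} {c} {d} {ε} h k with ⊔-sel a b
... | inj₁ e = subst (_< (c ⊔ d) + ε) (sym e) (<-≤-trans h (+-monoˡ-≤ ε (p≤p⊔q c d)))
... | inj₂ e = subst (_< (c ⊔ d) + ε) (sym e) (<-≤-trans k (+-monoˡ-≤ ε (p≤q⊔p c d)))

⊓-below : ∀ {a b c d ε} → a < c + ε → b < d + ε → a ⊓ b < (c ⊓ d) + ε
⊓-below {a} {b} {c} {d} {ε} h k with ⊓-sel c d
... | inj₁ e = subst (λ z → a ⊓ b < z + ε) (sym e) (≤-<-trans (p⊓q≤p a b) h)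
... | inj₂ e = subst (λ z → a ⊓ b < z + ε) (sym e) (≤-<-trans (p⊓q≤q a b) k)

⊔-near : ∀ a b c d {ε} → ∣ a - c ∣ < ε → ∣ b - d ∣ < ε → ∣ (a ⊔ b) - (c ⊔ d) ∣ < ε
⊔-near a b c d h k = <⇒near {a ⊔ b} {c ⊔ d}
  (⊔-below {a} {b} {c} {d} (near⇒< {a} {c} h) (near⇒< {b} {d} k))
  (⊔-below {c} {d} {a} {b} (near⇒> {a} {c} h) (near⇒> {b} {d} k))

⊓-near : ∀ a b c d {ε} → ∣ a - c ∣ < ε → ∣ b - d ∣ < ε → ∣ (a ⊓ b) - (c ⊓ d) ∣ < ε
⊓-near a b c d h k = <⇒near {a ⊓ b} {c ⊓ d}
  (⊓-below {a} {b} {c} {d} (near⇒< {a} {c} h) (near⇒< {b} {d} k))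
  (⊓-below {c} {d} {a} {b} (near⇒> {a} {c} h) (near⇒> {b} {d} k))

_⊔ℝ_ : ℝ → ℝ → ℝ
x ⊔ℝ y = mkℝ z (lift-cauchy x y z λ ε 0<ε →
  ε , 0<ε , 0 , λ m n _ _ → ⊔-near (seq x m) (seq y m) (seq x n) (seq y n))
  where
  z : ℕ → ℚ
  z n = seq x n ⊔ seq y n

_⊓ℝ_ : ℝ → ℝ → ℝ
x ⊓ℝ y = mkℝ z (lift-cauchy x y z λ ε 0<ε →
  ε , 0<ε , 0 , λ m n _ _ → ⊓-near (seq x m) (seq y m) (seq x n) (seq y n))
  where
  z : ℕ → ℚ
  z n = seq x n ⊓ seq y n

-- √ x is the square root of max(0, x); it is only used for x ≥ 0.
√ : ℝ → ℝ
√ x = mkℝ z (lift-cauchy (0ℝ ⊔ℝ x) (0ℝ ⊔ℝ x) z λ ε 0<ε →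
  let h = ½ * ε
      0<h = 0<½* 0<ε
      M , small = 1/suc-small 0<h
      below : ∀ m n → M ℕ.≤ n → x⁺ m < x⁺ n + h * h → z m < z n + ε
      below = λ m n M≤n near → subst (λ e → z m < z n + e) (½+½ ε)
        (√-near {h} {z m} {z n} {x⁺ m} {x⁺ n} {1/suc n}
          0<h (√-nonneg n (0≤x⁺ n)) (0<1/suc n) (small n M≤n)
          (√-lower m (0≤x⁺ m)) (√-upper n (0≤x⁺ n)) near)
  in h * h , 0<* 0<h 0<h , M , λ m n M≤m M≤n near _ →
     <⇒near {z m} {z n} (below m n M≤n (near⇒< {x⁺ m} {x⁺ n} near))
       (below n m M≤m (near⇒> {x⁺ m} {x⁺ n} near)))
  where
  x⁺ z : ℕ → ℚ
  x⁺ n = 0ℚ ⊔ seq x n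
  z n = √ℚ n (x⁺ n)
  0≤x⁺ : ∀ n → 0ℚ ≤ x⁺ n
  0≤x⁺ n = p≤p⊔q 0ℚ (seq x n)

1/-near : ∀ {δ a b η} (0<δ : 0ℚ < δ) (0<a : 0ℚ < a) (0<b : 0ℚ < b) → δ ≤ a → δ ≤ b →
          ∣ a - b ∣ < δ * δ * η →
          ∣ (1/ a) {{>-nonZero 0<a}} - (1/ b) {{>-nonZero 0<b}} ∣ < η
1/-near {δ} {a} {b} {η} 0<δ 0<a 0<b δ≤a δ≤b near =
  *-cancelˡ-<-nonNeg (a * b) {{nonNegative (<⇒≤ (0<* 0<a 0<b))}}
    (subst (_< a * b * η) diff
      (<-≤-trans near
        (*-monoʳ-≤-nonNeg η {{nonNegative 0≤η}}
          (≤-trans (*-monoˡ-≤-nonNeg δ {{nonNegative 0≤δ}} δ≤b)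
                   (*-monoʳ-≤-nonNeg b {{nonNegative (<⇒≤ 0<b)}} δ≤a)))))
  where
  instance
    a≢0 : NonZero a
    a≢0 = >-nonZero 0<a
    b≢0 : NonZero b
    b≢0 = >-nonZero 0<b
  0≤δ = <⇒≤ 0<δ
  0≤η : 0ℚ ≤ η
  0≤η = *-cancelˡ-≤-pos (δ * δ) {{positive (0<* 0<δ 0<δ)}}
    (subst (_≤ δ * δ * η) (sym (*-zeroʳ (δ * δ))) (≤-trans (0≤∣p∣ (a - b)) (<⇒≤ near)))
  open ≡-Reasoning
  inv : a * b * (1/ a - 1/ b) ≡ b - a
  inv = begin
    a * b * (1/ a - 1/ b)
      ≡⟨ solve 4 (λ a b i j → a :* b :* (i :- j) := b :* (a :* i) :- a :* (b :* j)) refl a b (1/ a) (1/ b) ⟩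
    b * (a * 1/ a) - a * (b * 1/ b)
      ≡⟨ cong (λ z → b * z - a * (b * 1/ b)) (*-inverseʳ a) ⟩
    b * 1ℚ - a * (b * 1/ b)
      ≡⟨ cong (λ z → b * 1ℚ - a * z) (*-inverseʳ b) ⟩
    b * 1ℚ - a * 1ℚ
      ≡⟨ solve 2 (λ a b → b :* con 1ℚ :- a :* con 1ℚ := b :- a) refl a b ⟩
    b - a ∎
  diff : ∣ a - b ∣ ≡ a * b * ∣ 1/ a - 1/ b ∣
  diff = begin
    ∣ a - b ∣                    ≡⟨ ∣p-q∣≡∣q-p∣ a b ⟩
    ∣ b - a ∣                    ≡⟨ cong ∣_∣ (sym inv) ⟩
    ∣ a * b * (1/ a - 1/ b) ∣    ≡⟨ ∣p*q∣≡∣p∣*∣q∣ (a * b) (1/ a - 1/ b) ⟩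
    ∣ a * b ∣ * ∣ 1/ a - 1/ b ∣  ≡⟨ cong (_* ∣ 1/ a - 1/ b ∣) (0≤p⇒∣p∣≡p (<⇒≤ (0<* 0<a 0<b))) ⟩
    a * b * ∣ 1/ a - 1/ b ∣      ∎

-- Reciprocal of a positive real.  The witness provides δ > 0 with δ ≤ seq x n
-- for all large n, so the sequence is eventually 1 / seq x n.
recip : (x : ℝ) → 0ℝ <ℝ x → ℝ
recip x (δ , 0<δ , _) = mkℝ z (lift-cauchy (fromℚ δ ⊔ℝ x) (fromℚ δ ⊔ℝ x) z λ ε 0<ε →
    δ * δ * ε , 0<* (0<* 0<δ 0<δ) 0<ε , 0 , λ m n _ _ near _ →
    1/-near {δ} {δ ⊔ seq x m} {δ ⊔ seq x n} {ε}
      0<δ (0< m) (0< n) (p≤p⊔q δ (seq x m)) (p≤p⊔q δ (seq x n)) near)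
  where
  0< : ∀ n → 0ℚ < δ ⊔ seq x n
  0< n = <-≤-trans 0<δ (p≤p⊔q δ (seq x n))
  z : ℕ → ℚ
  z n = (1/ (δ ⊔ seq x n)) {{>-nonZero (0< n)}}

record Point : Set where
  constructor _,_
  field
    x-coord y-coord : ℝ

open Point public

infix 4 _≈ₚ_ _#ₚ_

_≈ₚ_ : Rel Point 0ℓ
P ≈ₚ Q = x-coord P ≈ℝ x-coord Q × y-coord P ≈ℝ y-coord Q

_#ₚ_ : Rel Point 0ℓ
P #ₚ Q = x-coord P #ℝ x-coord Q ⊎ y-coord P #ℝ y-coord Q

dist : Point → Point → ℝ
dist P Q = √ (Δx *ℝ Δx +ℝ Δy *ℝ Δy)
  where
  Δx = x-coord P -ℝ x-coord Q
  Δy = y-coord P -ℝ y-coord Q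

OnSegment : Point → Point → Point → Set
OnSegment P Q R = Σ[ t ∈ ℝ ] (0ℝ ≤ℝ t × t ≤ℝ 1ℝ ×
  R ≈ₚ ( (1ℝ -ℝ t) *ℝ x-coord P +ℝ t *ℝ x-coord Q
       , (1ℝ -ℝ t) *ℝ y-coord P +ℝ t *ℝ y-coord Q ))

0≤square : ∀ p → 0ℚ ≤ p * p
0≤square p = subst (0ℚ ≤_) (eq (∣p∣≡p∨∣p∣≡-p p)) (0≤* (0≤∣p∣ p) (0≤∣p∣ p))
  where
  eq : ∣ p ∣ ≡ p ⊎ ∣ p ∣ ≡ - p → ∣ p ∣ * ∣ p ∣ ≡ p * p
  eq (inj₁ e) = trans (cong (λ z → z * z) e) refl
  eq (inj₂ e) = trans (cong (λ z → z * z) e) (solve 1 (λ a → (:- a) :* (:- a) := a :* a) refl p)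

#⇒square-positive : ∀ x y → x #ℝ y → 0ℝ <ℝ (x -ℝ y) *ℝ (x -ℝ y)
#⇒square-positive x y (inj₁ (δ , 0<δ , N , h)) = δ * δ , 0<* 0<δ 0<δ , N , λ n N≤n →
  subst₂ _≤_ (sym (+-identityˡ (δ * δ)))
    (solve 2 (λ a b → (b :- a) :* (b :- a) := (a :- b) :* (a :- b)) refl (seq x n) (seq y n))
    (square-mono-≤ (<⇒≤ 0<δ) (subst (_≤ seq y n - seq x n)
      (solve 2 (λ a d → (a :+ d) :- a := d) refl (seq x n) δ)
      (+-monoˡ-≤ (- seq x n) (h n N≤n))))
#⇒square-positive x y (inj₂ (δ , 0<δ , N , h)) = δ * δ , 0<* 0<δ 0<δ , N , λ n N≤n →
  subst (_≤ (seq x n - seq y n) * (seq x n - seq y n)) (sym (+-identityˡ (δ * δ)))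
    (square-mono-≤ (<⇒≤ 0<δ) (subst (_≤ seq x n - seq y n)
      (solve 2 (λ a d → (a :+ d) :- a := d) refl (seq y n) δ)
      (+-monoˡ-≤ (- seq y n) (h n N≤n))))

√-positive : ∀ x → 0ℝ <ℝ x → 0ℝ <ℝ √ x
√-positive x (δ , 0<δ , N , h) = η , 0<η , N ℕ.⊔ M , λ n p →
    subst (_≤ √ℚ n (0ℚ ⊔ seq x n)) (sym (+-identityˡ η))
      (≮⇒≥ λ s<η → <-irrefl refl (<-≤-trans
        (<-≤-trans (√-upper n (p≤p⊔q 0ℚ (seq x n)))
          (≤-trans
            (square-mono-≤
              (0≤+ (√-nonneg n (p≤p⊔q 0ℚ (seq x n))) (<⇒≤ (0<1/suc n)))
              (subst (√ℚ n (0ℚ ⊔ seq x n) + 1/suc n ≤_) (½+½ (δ ⊓ 1ℚ))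
                (+-mono-≤ (<⇒≤ s<η) (small n (ℕ.≤-trans (ℕ.m≤n⊔m N M) p)))))
            c²≤δ))
        (≤-trans (subst (_≤ seq x n) (+-identityˡ δ) (h n (ℕ.≤-trans (ℕ.m≤m⊔n N M) p)))
          (p≤q⊔p 0ℚ (seq x n)))))
  where
  0<c : 0ℚ < δ ⊓ 1ℚ
  0<c with ⊓-sel δ 1ℚ
  ... | inj₁ e = subst (0ℚ <_) (sym e) 0<δ
  ... | inj₂ e = subst (0ℚ <_) (sym e) (positive⁻¹ 1ℚ)
  c²≤δ : (δ ⊓ 1ℚ) * (δ ⊓ 1ℚ) ≤ δ
  c²≤δ = ≤-trans
    (subst ((δ ⊓ 1ℚ) * (δ ⊓ 1ℚ) ≤_) (*-identityʳ (δ ⊓ 1ℚ))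
      (*-monoˡ-≤-nonNeg (δ ⊓ 1ℚ) {{nonNegative (<⇒≤ 0<c)}} (p⊓q≤q δ 1ℚ)))
    (p⊓q≤p δ 1ℚ)
  η = ½ * (δ ⊓ 1ℚ)
  0<η = 0<½* 0<c
  M = proj₁ (1/suc-small 0<η)
  small = proj₂ (1/suc-small 0<η)

dist-positive : ∀ P Q → P #ₚ Q → 0ℝ <ℝ dist P Q
dist-positive P Q P#Q = √-positive (Δx *ℝ Δx +ℝ Δy *ℝ Δy) (positive-sum P#Q)
  where
  Δx = x-coord P -ℝ x-coord Q
  Δy = y-coord P -ℝ y-coord Q
  positive-sum : P #ₚ Q → 0ℝ <ℝ Δx *ℝ Δx +ℝ Δy *ℝ Δy
  positive-sum (inj₁ p) =
    let δ , 0<δ , N , h = #⇒square-positive (x-coord P) (x-coord Q) p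
    in δ , 0<δ , N , λ n N≤n → ≤-trans (h n N≤n)
       (p≤p+q (seq (Δx *ℝ Δx) n) (0≤square (seq Δy n)))
  positive-sum (inj₂ p) =
    let δ , 0<δ , N , h = #⇒square-positive (y-coord P) (y-coord Q) p
    in δ , 0<δ , N , λ n N≤n → ≤-trans (h n N≤n)
       (subst (seq (Δy *ℝ Δy) n ≤_) (+-comm (seq (Δy *ℝ Δy) n) (seq (Δx *ℝ Δx) n))
         (p≤p+q (seq (Δy *ℝ Δy) n) (0≤square (seq Δx n))))

record Graph : Set₁ where
  infix 4 _~_ _~?_
  field
    order    : ℕ
    _~_      : Rel (Fin order) 0ℓ
    _~?_     : Decidable _~_
    ~-sym    : Symmetric _~_
    ~-irrefl : ∀ {u} → ¬ (u ~ u)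

  Vertex : Set
  Vertex = Fin order

module _ (G : Graph) where
  open Graph G

  -- A path is given by its sequence of vertices, without repetition.
  IsPath : Vertex → Vertex → List Vertex → Set
  IsPath u v vs = head vs ≡ just u × last vs ≡ just v × Linked _~_ vs × Unique vs

  isPath? : ∀ u v vs → Dec (IsPath u v vs)
  isPath? u v vs =
    ≡-dec Fin._≟_ (head vs) (just u) ×-dec ≡-dec Fin._≟_ (last vs) (just v) ×-dec
    linked? _~?_ vs ×-dec UniqueDec.unique? Fin._≟_ vs

  Connected : Set
  Connected = ∀ u v → ∃[ vs ] IsPath u v vs

  vertexSequences : ℕ → List (List Vertex)
  vertexSequences zero    = [] ∷ []
  vertexSequences (suc k) = cartesianProductWith _∷_ (allFin order) (vertexSequences k)

  -- All paths from u to v: a path has at most `order` vertices (see paths-complete).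
  paths : Vertex → Vertex → List (List Vertex)
  paths u v = filter (isPath? u v) (concatMap vertexSequences (upTo (suc order)))

  vertexSequences-complete : ∀ vs → vs ∈ vertexSequences (length vs)
  vertexSequences-complete []       = here refl
  vertexSequences-complete (v ∷ vs) =
    ∈-cartesianProductWith⁺ _∷_ (∈-allFin v) (vertexSequences-complete vs)

  unique⇒lookup-distinct : ∀ {vs : List Vertex} → Unique vs → ∀ i j → i Fin.< j → lookup vs i ≢ lookup vs j
  unique⇒lookup-distinct (p ∷ ps) zero    (suc j) _   = All.lookup p (∈-lookup j)
  unique⇒lookup-distinct (p ∷ ps) (suc i) (suc j) i<j =
    unique⇒lookup-distinct ps i j (ℕ.s<s⁻¹ i<j)

  unique⇒length≤order : ∀ {vs : List Vertex} → Unique vs → length vs ℕ.≤ order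
  unique⇒length≤order {vs} us = ℕ.≮⇒≥ λ order< →
    let i , j , i<j , e = Fin.pigeonhole order< (lookup vs)
    in unique⇒lookup-distinct us i j i<j e

  paths-complete : ∀ {u v vs} → IsPath u v vs → vs ∈ paths u v
  paths-complete {u} {v} {vs} p@(_ , _ , _ , us) = ∈-filter⁺ (isPath? u v)
    (∈-concatMap⁺ vertexSequences
      (lose (∈-upTo⁺ (ℕ.s≤s (unique⇒length≤order us))) (vertexSequences-complete vs)))
    p

-- The edges are drawn as the segments between the images of their end-vertices,
-- so a drawing is determined by the placement of the vertices.  Distinctness is
-- stated as apartness, the form needed to divide by the distance of two vertices.
record Drawing (G : Graph) : Set where
  open Graph G
  field
    point    : Vertex → Point
    distinct : ∀ {u v} → u ≢ v → point u #ₚ point v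

module _ {G : Graph} where
  open Graph G

  Proper : Drawing G → Set
  Proper Γ = ∀ u v w → u ~ v → w ≢ u → w ≢ v → ¬ OnSegment (point u) (point v) (point w)
    where open Drawing Γ

  module _ (Γ : Drawing G) where
    open Drawing Γ

    pathLength : List Vertex → ℝ
    pathLength (u ∷ v ∷ vs) = dist (point u) (point v) +ℝ pathLength (v ∷ vs)
    pathLength (_ ∷ [])     = 0ℝ
    pathLength []           = 0ℝ

    -- Minimum length of a u–v path.  The minimum is seeded with the length of
    -- one of these paths, which connectedness provides.
    π : Connected G → Vertex → Vertex → ℝ
    π conn u v = foldr _⊓ℝ_ (pathLength (proj₁ (conn u v))) (map pathLength (paths G u v))

    -- π(u,v) / ‖uv‖, or nothing when u = v.
    ratio : Connected G → Vertex → Vertex → List ℝ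
    ratio conn u v with u Fin.≟ v
    ... | yes _   = []
    ... | no  u≢v =
      π conn u v *ℝ recip (dist (point u) (point v)) (dist-positive (point u) (point v) (distinct u≢v)) ∷ []

    ratios : Connected G → List ℝ
    ratios conn = concatMap (λ u → concatMap (ratio conn u) (allFin order)) (allFin order)

    -- Ratios are nonnegative, so starting from 0 only matters when there is no
    -- pair of distinct vertices, where it fixes the value of the empty maximum.
    spanningRatio : Connected G → ℝ
    spanningRatio conn = foldr _⊔ℝ_ 0ℝ (ratios conn)

{-# OPTIONS --safe #-}
-- List the vertices as v₁, …, vₙ so that each vᵢ with i < n has a neighbour further
-- right, and place vᵢ at (hⁱ, h²ⁱ) for a small rational h.  No three points of a
-- parabola are collinear, so the drawing is proper.  For i < j some path from vᵢ to
-- vⱼ uses only vertices right of vᵢ after its first step.  With X = hⁱ, that step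
-- has length at most (1 + h) X and each of the fewer than n others at most
-- (1 + h) h X, while ‖vᵢvⱼ‖ ≥ (1 − h) X; so the ratio tends to 1 as h → 0.
module Submission where

open import Data.Empty using (⊥-elim)
open import Data.Fin.Base using (Fin)
import Data.Fin.Properties as Fin
open import Data.List.Base using (List; []; _∷_; _∷ʳ_; allFin; foldr; last; length)
import Data.List.Membership.DecPropositional as DecMembership
open import Data.List.Membership.Propositional using (_∈_; _∉_)
open import Data.List.Membership.Propositional.Properties using (∈-allFin; ∈-map⁺)
open import Data.List.Properties using (length-++-≤ˡ)
open import Data.List.Relation.Binary.Subset.Propositional using (_⊆_)
open import Data.List.Relation.Unary.All as All using (All; []; _∷_)
import Data.List.Relation.Unary.All.Properties as All
open import Data.List.Relation.Unary.AllPairs using (AllPairs; []; _∷_)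
import Data.List.Relation.Unary.AllPairs.Properties as AllPairs
open import Data.List.Relation.Unary.Any using (here; there)
open import Data.List.Relation.Unary.Linked using (Linked; [-]; _∷_)
open import Data.List.Relation.Unary.Unique.Propositional using (Unique)
open import Data.Maybe.Base using (just)
open import Data.Nat.Base as ℕ using (ℕ; suc)
import Data.Nat.Properties as ℕ
open import Data.Product.Base using (Σ-syntax; ∃-syntax; _×_; _,_; proj₁; proj₂)
open import Data.Rational.Base
open import Data.Rational.Properties
open import Data.Rational.Solver using (module +-*-Solver)
open import Data.Sum.Base using (_⊎_; inj₁; inj₂; [_,_]′)
open import Level using (0ℓ)
open import Relation.Binary.Core using (Rel)
open import Relation.Binary.Definitions using (tri<; tri≈; tri>)
open import Relation.Binary.PropositionalEquality using (_≡_; _≢_; refl; sym; trans; cong; cong₂; subst; subst₂)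
open import Relation.Nullary using (¬_; yes; no)
open import Defs

open +-*-Solver using (solve; _:=_; con; _:+_; _:*_; _:-_; :-_)

-- Auxiliary facts on lists.

last-∷ʳ : ∀ {A : Set} (xs : List A) y → last (xs ∷ʳ y) ≡ just y
last-∷ʳ []           y = refl
last-∷ʳ (x ∷ [])     y = refl
last-∷ʳ (_ ∷ x ∷ xs) y = last-∷ʳ (x ∷ xs) y

linked-∷ʳ : ∀ {A : Set} {R : Rel A 0ℓ} {xs y z} →
            Linked R xs → last xs ≡ just y → R y z → Linked R (xs ∷ʳ z)
linked-∷ʳ [-]       refl Ryz = Ryz ∷ [-]
linked-∷ʳ (r ∷ rs) eq   Ryz = r ∷ linked-∷ʳ rs eq Ryz

allPairs-map : ∀ {A : Set} {P : A → Set} {R S : Rel A 0ℓ} {xs} →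
               (∀ {x y} → P x → P y → R x y → S x y) →
               All P xs → AllPairs R xs → AllPairs S xs
allPairs-map f []         []         = []
allPairs-map f (px ∷ pxs) (rx ∷ rxs) =
  All.zipWith (λ (py , r) → f px py r) (pxs , rx) ∷ allPairs-map f pxs rxs

-- Vertex orderings with connected suffixes, and paths inside a suffix.

module _ (G : Graph) where
  open Graph G
  open DecMembership (Fin._≟_ {order}) using (_∈?_)

  private
    variable
      u v w p r : Vertex
      vs L : List Vertex

  cons-path : w ~ p → w ∉ vs → IsPath G p v vs → IsPath G w v (w ∷ vs)
  cons-path {vs = _ ∷ _} w~p w∉ (refl , end , links , uniq) =
    refl , end , w~p ∷ links , All.¬Any⇒All¬ _ w∉ ∷ uniq

  snoc-path : p ~ w → w ∉ vs → IsPath G u p vs → IsPath G u w (vs ∷ʳ w)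
  snoc-path {vs = vs@(_ ∷ _)} p~w w∉ (refl , end , links , uniq) =
    refl , last-∷ʳ vs _ , linked-∷ʳ links end p~w ,
    AllPairs.++⁺ uniq ([] ∷ []) (All.map (λ w≢x → (λ x≡w → w≢x (sym x≡w)) ∷ []) (All.¬Any⇒All¬ _ w∉))

  -- Every vertex but the last has a neighbour later in the list, so every
  -- suffix spans a connected subgraph.
  data Grown : List Vertex → Set where
    []   : Grown []
    grow : v ∉ L → (∀ {u} → u ∈ L → ∃[ p ] (p ∈ L × v ~ p)) → Grown L → Grown (v ∷ L)

  grown-unique : Grown L → Unique L
  grown-unique []              = []
  grown-unique (grow v∉ _ g) = All.¬Any⇒All¬ _ v∉ ∷ grown-unique g

  Extension : List Vertex → Vertex → Set
  Extension L v = ∃[ L′ ] (Grown L′ × v ∈ L′ × L ⊆ L′)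

  insert : ∀ v → (∀ {u} → u ∈ L → ∃[ p ] (p ∈ L × v ~ p)) → Grown L → Extension L v
  insert {L} v adj g with v ∈? L
  ... | yes v∈ = L , g , v∈ , λ u∈ → u∈
  ... | no  v∉ = v ∷ L , grow v∉ adj g , here refl , there

  -- The path is inserted backwards from its end `r`, which is already in the list, so each vertex
  -- finds its successor on the path present as the neighbour that `grow` requires.
  insert-path : ∀ v vs → Linked _~_ (v ∷ vs) → last (v ∷ vs) ≡ just r → r ∈ L → Grown L → Extension L v
  insert-path v [] _ refl r∈ g = _ , g , r∈ , λ u∈ → u∈
  insert-path v (w ∷ vs) (v~w ∷ links) end r∈ g =
    let L₁ , g₁ , w∈ , L⊆L₁   = insert-path w vs links end r∈ g
        L₂ , g₂ , v∈ , L₁⊆L₂ = insert v (λ _ → w , w∈ , v~w) g₁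
    in L₂ , g₂ , v∈ , λ u∈ → L₁⊆L₂ (L⊆L₁ u∈)

  module _ (conn : Connected G) where

    insert-vertex : ∀ v → Grown L → Extension L v
    insert-vertex {[]} v g = insert v (λ ()) g
    insert-vertex {r ∷ L} v g with conn v r
    ... | _ ∷ vs , refl , end , links , _ = insert-path v vs links end (here refl) g

    grow-to : ∀ ws → ∃[ L ] (Grown L × ws ⊆ L)
    grow-to [] = [] , [] , λ ()
    grow-to (w ∷ ws) =
      let L , g , ws⊆L = grow-to ws
          L′ , g′ , w∈ , L⊆L′ = insert-vertex w g
      in L′ , g′ , λ { (here refl) → w∈ ; (there u∈) → L⊆L′ (ws⊆L u∈) }

    connected-order : ∃[ L ] (Grown L × (∀ v → v ∈ L))
    connected-order = let L , g , all = grow-to (allFin order) in L , g , λ v → all (∈-allFin v)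

  -- By induction on the list: an end-vertex at the head first moves to a neighbour in the tail.
  -- Recording that the path found there stays in the tail shows that the head does not repeat.
  grown-connected : Grown L → u ∈ L → v ∈ L → ∃[ vs ] (IsPath G u v vs × All (_∈ L) vs)
  grown-connected (grow _ _ g) (here refl) (here refl) =
    _ ∷ [] , (refl , refl , [-] , [] ∷ []) , here refl ∷ []
  grown-connected (grow w∉ adj g) (here refl) (there v∈) =
    let p , p∈ , w~p = adj v∈
        vs , path , vs⊆ = grown-connected g p∈ v∈
    in _ ∷ vs , cons-path w~p (λ w∈ → w∉ (All.lookup vs⊆ w∈)) path , here refl ∷ All.map there vs⊆
  grown-connected (grow w∉ adj g) (there u∈) (here refl) =
    let p , p∈ , w~p = adj u∈
        vs , path , vs⊆ = grown-connected g u∈ p∈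
    in vs ∷ʳ _ , snoc-path (~-sym w~p) (λ w∈ → w∉ (All.lookup vs⊆ w∈)) path ,
       All.∷ʳ⁺ (All.map there vs⊆) (here refl)
  grown-connected (grow _ _ g) (there u∈) (there v∈) =
    let vs , path , vs⊆ = grown-connected g u∈ v∈
    in vs , path , All.map there vs⊆

  -- The two cases say which end-vertex dominates the rest of the path: the start for `Leaves`, the
  -- end for `Arrives`. Either may come earlier in the ordering.
  Leaves Arrives : (R : Rel Vertex 0ℓ) → Vertex → Vertex → Set
  Leaves  R u v = ∃[ vs ] (IsPath G u v (u ∷ vs) × R u v × All (R u) vs)
  Arrives R u v = ∃[ vs ] (IsPath G u v (vs ∷ʳ v) × R v u × All (R v) vs)

  -- Heads are dropped until one of `u`, `v` is the head. It is then `R`-related to the whole tail,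
  -- and the rest of the path can be chosen inside the tail.
  dominated-path : ∀ {R : Rel Vertex 0ℓ} → Grown L → AllPairs R L → u ∈ L → v ∈ L → u ≢ v →
                   Leaves R u v ⊎ Arrives R u v
  dominated-path _ _ (here refl) (here refl) u≢v = ⊥-elim (u≢v refl)
  dominated-path (grow w∉ adj g) (Rw ∷ _) (here refl) (there v∈) _ =
    let p , p∈ , w~p = adj v∈
        vs , path , vs⊆ = grown-connected g p∈ v∈
    in inj₁ (vs , cons-path w~p (λ w∈ → w∉ (All.lookup vs⊆ w∈)) path ,
             All.lookup Rw v∈ , All.map (All.lookup Rw) vs⊆)
  dominated-path (grow w∉ adj g) (Rw ∷ _) (there u∈) (here refl) _ =
    let p , p∈ , w~p = adj u∈
        vs , path , vs⊆ = grown-connected g u∈ p∈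
    in inj₂ (vs , snoc-path (~-sym w~p) (λ w∈ → w∉ (All.lookup vs⊆ w∈)) path ,
             All.lookup Rw u∈ , All.map (All.lookup Rw) vs⊆)
  dominated-path (grow _ _ g) (_ ∷ Rs) (there u∈) (there v∈) u≢v = dominated-path g Rs u∈ v∈ u≢v

-- Rational inequalities and approximate square roots.

0≤⇒*-monoˡ-≤ : ∀ {p q} r → 0ℚ ≤ r → p ≤ q → r * p ≤ r * q
0≤⇒*-monoˡ-≤ r 0≤r = *-monoˡ-≤-nonNeg r {{nonNegative 0≤r}}

0≤⇒*-monoʳ-≤ : ∀ {p q} r → 0ℚ ≤ r → p ≤ q → p * r ≤ q * r
0≤⇒*-monoʳ-≤ r 0≤r = *-monoʳ-≤-nonNeg r {{nonNegative 0≤r}}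

0≤q-p : ∀ {p q} → p ≤ q → 0ℚ ≤ q - p
0≤q-p {p} {q} p≤q = subst (_≤ q - p) (+-inverseʳ p) (+-monoˡ-≤ (- p) p≤q)

0<q-p : ∀ {p q} → p < q → 0ℚ < q - p
0<q-p {p} {q} p<q = subst (_< q - p) (+-inverseʳ p) (+-monoˡ-< (- p) p<q)

p-q≤p : ∀ p {q} → 0ℚ ≤ q → p - q ≤ p
p-q≤p p {q} 0≤q = subst (p - q ≤_)
  (solve 2 (λ p q → p :- q :+ q := p) refl p q) (p≤p+q (p - q) 0≤q)

square-swap : ∀ p q → (q - p) * (q - p) ≡ (p - q) * (p - q)
square-swap = solve 2 (λ p q → (q :- p) :* (q :- p) := (p :- q) :* (p :- q)) refl

difference-square-≤ : ∀ {p q r} → 0ℚ ≤ p → p ≤ r → 0ℚ ≤ q → q ≤ r → (p - q) * (p - q) ≤ r * r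
difference-square-≤ {p} {q} {r} 0≤p p≤r 0≤q q≤r with ≤-total q p
... | inj₁ q≤p = square-mono-≤ (0≤q-p q≤p) (≤-trans (p-q≤p p 0≤q) p≤r)
... | inj₂ p≤q = subst (_≤ r * r) (square-swap p q)
      (square-mono-≤ (0≤q-p p≤q) (≤-trans (p-q≤p q 0≤p) q≤r))

square-cancel-≤ : ∀ {p q} → 0ℚ ≤ q → p * p ≤ q * q → p ≤ q
square-cancel-≤ {p} {q} 0≤q p²≤q² = ≮⇒≥ λ q<p → <-irrefl refl (<-≤-trans (q²<p² q<p) p²≤q²)
  where
  q²<p² : q < p → q * q < p * p
  q²<p² q<p = ≤-<-trans (0≤⇒*-monoˡ-≤ q 0≤q (<⇒≤ q<p))
    (*-monoˡ-<-pos p {{positive (≤-<-trans 0≤q q<p)}} q<p)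

√ℚ-≤ : ∀ n {q s} → 0ℚ ≤ q → 0ℚ ≤ s → q ≤ s * s → √ℚ n q ≤ s
√ℚ-≤ n 0≤q 0≤s q≤s² = square-cancel-≤ 0≤s (≤-trans (√-lower n 0≤q) q≤s²)

<-√ℚ : ∀ n {q a} → 0ℚ ≤ q → a * a ≤ q → a < √ℚ n q + 1/suc n
<-√ℚ n {q} {a} 0≤q a²≤q = ≰⇒> λ s≤a → <-irrefl refl
  (<-≤-trans (√-upper n 0≤q)
    (≤-trans (square-mono-≤ {√ℚ n q + 1/suc n} {a}
      (0≤+ {√ℚ n q} {1/suc n} (√-nonneg n 0≤q) (<⇒≤ (0<1/suc n))) s≤a) a²≤q))

-- Distances and collinearity on the parabola.

parabola : ℚ → Point
parabola p = fromℚ p , fromℚ (p * p)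

chord² : ℚ → ℚ → ℚ
chord² p q = (p - q) * (p - q) + (p * p - q * q) * (p * p - q * q)

0≤chord² : ∀ p q → 0ℚ ≤ chord² p q
0≤chord² p q = 0≤+ {(p - q) * (p - q)} (0≤square (p - q)) (0≤square (p * p - q * q))

-- The coordinates are constant sequences, and the cut-off at 0 in `√` has no effect on a sum of
-- squares; so `n` enters only as the precision of the root.
seq-dist : ∀ p q n → seq (dist (parabola p) (parabola q)) n ≡ √ℚ n (chord² p q)
seq-dist p q n = cong (√ℚ n) (p≤q⇒p⊔q≡q (0≤chord² p q))

-- Since X ≤ h, squares of numbers in [0, X] lie in [0, hX]. The chord thus spans at most X by hX,
-- and X² + (hX)² ≤ ((1 + h) X)².
dist-≤ : ∀ {h p q X} n → 0ℚ ≤ h → X ≤ h → 0ℚ ≤ p → p ≤ X → 0ℚ ≤ q → q ≤ X →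
         seq (dist (parabola p) (parabola q)) n ≤ (1ℚ + h) * X
dist-≤ {h} {p} {q} {X} n 0≤h X≤h 0≤p p≤X 0≤q q≤X =
  subst (_≤ (1ℚ + h) * X) (sym (seq-dist p q n))
    (√ℚ-≤ n (0≤chord² p q) 0≤cX
      (≤-trans
        (+-mono-≤ (difference-square-≤ 0≤p p≤X 0≤q q≤X)
          (difference-square-≤ (0≤* 0≤p 0≤p) (p²≤hX 0≤p p≤X) (0≤* 0≤q 0≤q) (p²≤hX 0≤q q≤X)))
        (subst (X * X + (h * X) * (h * X) ≤_)
          (solve 2 (λ h X → X :* X :+ (h :* X) :* (h :* X) :+ ((h :* X) :* X :+ (h :* X) :* X)
                            := ((con 1ℚ :+ h) :* X) :* ((con 1ℚ :+ h) :* X)) refl h X)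
          (p≤p+q (X * X + (h * X) * (h * X)) (0≤+ 0≤hXX 0≤hXX)))))
  where
  0≤X = ≤-trans 0≤p p≤X
  0≤hXX = 0≤* (0≤* 0≤h 0≤X) 0≤X
  0≤cX : 0ℚ ≤ (1ℚ + h) * X
  0≤cX = 0≤* (0≤+ {1ℚ} (<⇒≤ (positive⁻¹ 1ℚ)) 0≤h) 0≤X
  p²≤hX : ∀ {p} → 0ℚ ≤ p → p ≤ X → p * p ≤ h * X
  p²≤hX {p} 0≤p p≤X = ≤-trans (square-mono-≤ 0≤p p≤X) (0≤⇒*-monoʳ-≤ X 0≤X X≤h)

-- The vertical difference only lengthens the chord; `1/suc n` pays for approximating the root from
-- below.
<-dist : ∀ p q {a} n → a * a ≤ (p - q) * (p - q) →
         a < seq (dist (parabola p) (parabola q)) n + 1/suc n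
<-dist p q {a} n a²≤ = subst (λ d → a < d + 1/suc n) (sym (seq-dist p q n))
  (<-√ℚ n (0≤chord² p q) (≤-trans a²≤ (p≤p+q ((p - q) * (p - q)) (0≤square (p * p - q * q)))))

≢⇒0<∣-∣ : ∀ {p q} → p ≢ q → 0ℚ < ∣ p - q ∣
≢⇒0<∣-∣ {p} {q} p≢q with <-cmp p q
... | tri< p<q _ _ = subst (0ℚ <_) (∣p-q∣≡∣q-p∣ q p) (<-≤-trans (0<q-p p<q) (p≤∣p∣ (q - p)))
... | tri≈ _ p≡q _ = ⊥-elim (p≢q p≡q)
... | tri> _ _ q<p = <-≤-trans (0<q-p q<p) (p≤∣p∣ (p - q))

fromℚ-mono-< : ∀ {p q} → p < q → fromℚ p <ℝ fromℚ q
fromℚ-mono-< {p} {q} p<q = q - p , 0<q-p p<q , 0 , λ _ _ →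
  ≤-reflexive (solve 2 (λ p q → p :+ (q :- p) := q) refl p q)

parabola-# : ∀ {p q} → p ≢ q → parabola p #ₚ parabola q
parabola-# {p} {q} p≢q with <-cmp p q
... | tri< p<q _ _ = inj₁ (inj₁ (fromℚ-mono-< p<q))
... | tri≈ _ p≡q _ = ⊥-elim (p≢q p≡q)
... | tri> _ _ q<p = inj₁ (inj₂ (fromℚ-mono-< q<p))

-- A point (r , s) of the line through (p , p²) and (q , q²) satisfies
-- s − (p + q) r + p q = 0, whose left side is (r − p)(r − q) when s = r².
parabola-not-collinear : ∀ {p q r} → r ≢ p → r ≢ q →
                         ¬ OnSegment (parabola p) (parabola q) (parabola r)
parabola-not-collinear {p} {q} {r} r≢p r≢q (t , _ , _ , x≈ , y≈) =
  <-irrefl refl (≤-<-trans d≤½d ½d<d)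
  where
  d = ∣ (r - p) * (r - q) ∣
  0<d : 0ℚ < d
  0<d = subst (0ℚ <_) (sym (∣p*q∣≡∣p∣*∣q∣ (r - p) (r - q))) (0<* (≢⇒0<∣-∣ r≢p) (≢⇒0<∣-∣ r≢q))
  ½d<d : ½ * d < d
  ½d<d = subst₂ _<_ (+-identityʳ (½ * d)) (½+½ d) (+-monoʳ-< (½ * d) (0<½* 0<d))
  K = 1ℚ + ∣ p + q ∣
  0<K : 0ℚ < K
  0<K = +-mono-<-≤ (positive⁻¹ 1ℚ) (0≤∣p∣ (p + q))
  -- With K e = d / 2, coordinate errors of at most `e` give d ≤ e + |p + q| e = d / 2,
  -- contradicting d > 0.
  e = (1/ K) {{>-nonZero 0<K}} * (½ * d)
  0<e : 0ℚ < e
  0<e = 0<* (0<1/ 0<K) (0<½* 0<d)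
  N₁ = proj₁ (x≈ e 0<e)
  N₂ = proj₁ (y≈ e 0<e)
  n = N₁ ℕ.⊔ N₂
  s = seq t n
  a = r - ((1ℚ + - s) * p + s * q)
  b = r * r - ((1ℚ + - s) * (p * p) + s * (q * q))
  ∣a∣≤e : ∣ a ∣ ≤ e
  ∣a∣≤e = proj₂ (x≈ e 0<e) n (ℕ.m≤m⊔n N₁ N₂)
  ∣b∣≤e : ∣ b ∣ ≤ e
  ∣b∣≤e = proj₂ (y≈ e 0<e) n (ℕ.m≤n⊔m N₁ N₂)
  -- The parameter `s` cancels from this combination of the two coordinate errors.
  eq : b + (- (p + q)) * a ≡ (r - p) * (r - q)
  eq = solve 4 (λ p q r s →
      (r :* r :- ((con 1ℚ :+ :- s) :* (p :* p) :+ s :* (q :* q)))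
        :+ (:- (p :+ q)) :* (r :- ((con 1ℚ :+ :- s) :* p :+ s :* q))
      := (r :- p) :* (r :- q)) refl p q r s
  d≤½d : d ≤ ½ * d
  d≤½d = ≤-trans
    (subst (λ z → ∣ z ∣ ≤ ∣ b ∣ + ∣ (- (p + q)) * a ∣) eq (∣p+q∣≤∣p∣+∣q∣ b ((- (p + q)) * a)))
    (subst (∣ b ∣ + ∣ (- (p + q)) * a ∣ ≤_)
      (trans (solve 2 (λ e k → e :+ k :* e := (con 1ℚ :+ k) :* e) refl e ∣ p + q ∣)
        (p*[1/p*q]≡q K 0<K (½ * d)))
      (+-mono-≤ ∣b∣≤e
        (subst (_≤ ∣ p + q ∣ * e)
          (sym (trans (∣p*q∣≡∣p∣*∣q∣ (- (p + q)) a) (cong (_* ∣ a ∣) (∣-p∣≡∣p∣ (p + q)))))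
          (0≤⇒*-monoˡ-≤ ∣ p + q ∣ (0≤∣p∣ (p + q)) ∣a∣≤e))))

0≤1+ : ∀ {p} → 0ℚ ≤ p → 0ℚ ≤ 1ℚ + p
0≤1+ = 0≤+ (<⇒≤ (positive⁻¹ 1ℚ))

0≤ι : ∀ n → 0ℚ ≤ ι n
0≤ι n = ι-mono-≤ {0} {n} ℕ.z≤n

+-ι-* : ∀ m c → c + ι m * c ≡ ι (suc m) * c
+-ι-* m c = trans (solve 2 (λ i c → c :+ i :* c := (i :+ con 1ℚ) :* c) refl (ι m) c)
  (cong (_* c) (sym (ι-suc m)))

-- Drawings on the parabola and the lengths of their paths.

module _ {G : Graph} (x : Graph.Vertex G → ℚ) (x-injective : ∀ {u v} → u ≢ v → x u ≢ x v) where
  open Graph G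

  parabolaDrawing : Drawing G
  parabolaDrawing = record
    { point    = λ v → parabola (x v)
    ; distinct = λ u≢v → parabola-# (x-injective u≢v)
    }

  parabolaDrawing-proper : Proper parabolaDrawing
  parabolaDrawing-proper u v w _ w≢u w≢v = parabola-not-collinear (x-injective w≢u) (x-injective w≢v)

  -- A bare refl would compare the distances as reals, unfolding the square roots.
  point-dist : ∀ u v → dist (parabola (x u)) (parabola (x v)) ≡
                       dist (Drawing.point parabolaDrawing u) (Drawing.point parabolaDrawing v)
  point-dist u v = cong₂ dist {x = parabola (x u)} {y = Drawing.point parabolaDrawing u}
    {u = parabola (x v)} {v = Drawing.point parabolaDrawing v} refl refl

  module _ {h : ℚ} (0≤h : 0ℚ ≤ h) (0≤x : ∀ v → 0ℚ ≤ x v) (n : ℕ) where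

    private
      len : List Vertex → ℚ
      len vs = seq (pathLength parabolaDrawing vs) n

    -- One edge is counted per vertex, one more than a nonempty path has; the slack is harmless and
    -- avoids a subtraction.
    pathLength-≤ : ∀ {X} → X ≤ h → ∀ vs → All (λ v → x v ≤ X) vs →
                   len vs ≤ ι (length vs) * ((1ℚ + h) * X)
    pathLength-≤ {X} X≤h [] _ = ≤-reflexive (sym (*-zeroˡ ((1ℚ + h) * X)))
    pathLength-≤ {X} X≤h (u ∷ []) (u≤ ∷ _) =
      0≤* (0≤ι 1) (0≤* (0≤1+ 0≤h) (≤-trans (0≤x u) u≤))
    pathLength-≤ {X} X≤h (u ∷ v ∷ vs) (u≤ ∷ v≤ ∷ vs≤) =
      subst (len (u ∷ v ∷ vs) ≤_) (+-ι-* (suc (length vs)) ((1ℚ + h) * X))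
        (+-mono-≤ (dist-≤ n 0≤h X≤h (0≤x u) u≤ (0≤x v) v≤) (pathLength-≤ X≤h (v ∷ vs) (v≤ ∷ vs≤)))

    module _ {X Y : ℚ} (X≤h : X ≤ h) (Y≤X : Y ≤ X) where

      private
        c : ℚ → ℚ
        c Z = (1ℚ + h) * Z

      -- Only the first edge meets `u` and may cost `c X`; every other edge joins vertices with
      -- abscissas at most Y.
      pathLength-∷-≤ : ∀ u vs → x u ≤ X → All (λ v → x v ≤ Y) vs →
                       len (u ∷ vs) ≤ c X + ι (length vs) * c Y
      pathLength-∷-≤ u [] u≤ [] = 0≤+ (0≤* (0≤1+ 0≤h) (≤-trans (0≤x u) u≤))
        (≤-reflexive (sym (*-zeroˡ (c Y))))
      pathLength-∷-≤ u (v ∷ vs) u≤ (v≤ ∷ vs≤) =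
        +-mono-≤ (dist-≤ n 0≤h X≤h (0≤x u) u≤ (0≤x v) (≤-trans v≤ Y≤X))
          (pathLength-≤ (≤-trans Y≤X X≤h) (v ∷ vs) (v≤ ∷ vs≤))

      pathLength-∷ʳ-≤ : ∀ vs v → All (λ w → x w ≤ Y) vs → x v ≤ X →
                        len (vs ∷ʳ v) ≤ c X + ι (length vs) * c Y
      pathLength-∷ʳ-≤ [] v [] v≤ = 0≤+ (0≤* (0≤1+ 0≤h) (≤-trans (0≤x v) v≤))
        (≤-reflexive (sym (*-zeroˡ (c Y))))
      pathLength-∷ʳ-≤ (u ∷ []) v (u≤ ∷ []) v≤ =
        +-mono-≤ (dist-≤ n 0≤h X≤h (0≤x u) (≤-trans u≤ Y≤X) (0≤x v) v≤)
          (0≤* (0≤ι 1) (0≤* (0≤1+ 0≤h) (≤-trans (0≤x u) u≤)))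
      pathLength-∷ʳ-≤ (u ∷ w ∷ vs) v (u≤ ∷ w≤ ∷ vs≤) v≤ =
        subst (len (u ∷ w ∷ vs ∷ʳ v) ≤_)
          -- Short edges are added in front of the long last one, so the new `c Y` has to be moved
          -- past `c X`.
          (trans (solve 3 (λ a b i → b :+ (a :+ i :* b) := a :+ (b :+ i :* b)) refl (c X) (c Y) (ι (suc (length vs))))
            (cong (c X +_) (+-ι-* (suc (length vs)) (c Y))))
          (+-mono-≤ (dist-≤ n 0≤h (≤-trans Y≤X X≤h) (0≤x u) u≤ (0≤x w) w≤)
            (pathLength-∷ʳ-≤ (w ∷ vs) v (w≤ ∷ vs≤) v≤))

-- Geometrically decaying abscissas.

module _ {n : ℕ} (h : ℚ) where

  -- h ^ (1 + position of v in L); the value at v ∉ L is junk.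
  geometric : List (Fin n) → Fin n → ℚ
  geometric []      v = h
  geometric (w ∷ L) v with v Fin.≟ w
  ... | yes _ = h
  ... | no  _ = h * geometric L v

  geometric-here : ∀ w L → geometric (w ∷ L) w ≡ h
  geometric-here w L with w Fin.≟ w
  ... | yes _  = refl
  ... | no w≢w = ⊥-elim (w≢w refl)

  geometric-there : ∀ {v w} L → w ≢ v → geometric (w ∷ L) v ≡ h * geometric L v
  geometric-there {v} {w} L w≢v with v Fin.≟ w
  ... | yes v≡w = ⊥-elim (w≢v (sym v≡w))
  ... | no _    = refl

  Decays : (Fin n → ℚ) → Rel (Fin n) 0ℓ
  Decays x v w = x w ≤ h * x v

  module _ (0<h : 0ℚ < h) (h≤1 : h ≤ 1ℚ) where

    geometric-positive : ∀ L v → 0ℚ < geometric L v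
    geometric-positive []      v = 0<h
    geometric-positive (w ∷ L) v with v Fin.≟ w
    ... | yes _ = 0<h
    ... | no  _ = 0<* 0<h (geometric-positive L v)

    geometric-≤ : ∀ L v → geometric L v ≤ h
    geometric-≤ []      v = ≤-refl
    geometric-≤ (w ∷ L) v with v Fin.≟ w
    ... | yes _ = ≤-refl
    ... | no  _ = subst (h * geometric L v ≤_) (*-identityʳ h)
                    (0≤⇒*-monoˡ-≤ h (<⇒≤ 0<h) (≤-trans (geometric-≤ L v) h≤1))

    -- A new head gets the value h, while all other values are multiplied by h. The latter are then
    -- at most h · h, and the decay among them survives the scaling; uniqueness keeps the head out
    -- of the tail.
    geometric-decays : ∀ {L} → Unique L → AllPairs (Decays (geometric L)) L
    geometric-decays [] = []
    geometric-decays {w ∷ L} (w≢ ∷ uniq) =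
      All.map (λ {v} w≢v → subst₂ _≤_ (sym (geometric-there L w≢v)) (cong (h *_) (sym (geometric-here w L)))
                (0≤⇒*-monoˡ-≤ h (<⇒≤ 0<h) (geometric-≤ L v))) w≢
      ∷ allPairs-map (λ w≢u w≢v dec →
          subst₂ _≤_ (sym (geometric-there L w≢v)) (cong (h *_) (sym (geometric-there L w≢u)))
            (0≤⇒*-monoˡ-≤ h (<⇒≤ 0<h) dec)) w≢ (geometric-decays uniq)

-- Choice of the scale h.

module _ {η : ℚ} (0<η : 0ℚ < η) (m : ℕ) where
  private
    -- g = η / (4 + η) makes (1 + η)(1 − g) − (1 + g)² equal to g − g².
    0<4+η : 0ℚ < ι 4 + η
    0<4+η = +-mono-< (0<ι-suc 3) 0<η
    g = (1/ (ι 4 + η)) {{>-nonZero 0<4+η}} * η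
    0<g : 0ℚ < g
    0<g = 0<* (0<1/ 0<4+η) 0<η
    [4+η]g : (ι 4 + η) * g ≡ η
    [4+η]g = p*[1/p*q]≡q (ι 4 + η) 0<4+η η
    g<1 : g < 1ℚ
    g<1 = *-cancelˡ-<-nonNeg (ι 4 + η) {{nonNegative (<⇒≤ 0<4+η)}}
      (subst₂ _<_ (sym [4+η]g) (sym (*-identityʳ (ι 4 + η)))
        (subst (_< ι 4 + η) (+-identityˡ η) (+-monoˡ-< η (0<ι-suc 3))))
    -- The denominator m + 2 gives both m h ≤ g and 2 h ≤ g.
    h = 1/suc (suc m) * g
    ι*h≤g : ∀ k → k ℕ.≤ suc (suc m) → ι k * h ≤ g
    ι*h≤g k k≤ = subst (ι k * h ≤_)
      (trans (sym (*-assoc (ι (suc (suc m))) (1/suc (suc m)) g))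
        (trans (cong (_* g) (1/suc-inverse (suc m))) (*-identityˡ g)))
      (0≤⇒*-monoʳ-≤ h (<⇒≤ 0<h) (ι-mono-≤ k≤))
      where
      0<h : 0ℚ < h
      0<h = 0<* (0<1/suc (suc m)) 0<g
    h≤g : h ≤ g
    h≤g = subst (_≤ g) (*-identityˡ h) (ι*h≤g 1 (ℕ.s≤s ℕ.z≤n))
    2h≤g : h + h ≤ g
    2h≤g = subst (_≤ g) (solve 1 (λ h → con (ι 2) :* h := h :+ h) refl h) (ι*h≤g 2 (ℕ.s≤s (ℕ.s≤s ℕ.z≤n)))
    g²≤g : g * g ≤ g
    g²≤g = subst (g * g ≤_) (*-identityʳ g) (0≤⇒*-monoˡ-≤ g (<⇒≤ 0<g) (<⇒≤ g<1))
    [1+g]² : (1ℚ + g) * (1ℚ + g) ≤ (1ℚ + η) * (1ℚ - g)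
    [1+g]² = subst ((1ℚ + g) * (1ℚ + g) ≤_)
      (trans
        (solve 2 (λ g η → (con 1ℚ :+ g) :* (con 1ℚ :+ g) :+ (g :- g :* g)
            := con 1ℚ :+ (con (ι 4) :+ η) :* g :- g :- η :* g) refl g η)
        (trans (cong (λ z → 1ℚ + z - g - η * g) [4+η]g)
          (solve 2 (λ g η → con 1ℚ :+ η :- g :- η :* g := (con 1ℚ :+ η) :* (con 1ℚ :- g)) refl g η)))
      (p≤p+q ((1ℚ + g) * (1ℚ + g)) (0≤q-p g²≤g))

  -- Both factors on the left are at most 1 + g, and 1 - 2h ≥ 1 - g. In 1 - 2h, one h covers the gap
  -- X - hX between abscissas and the other the error of the approximate distance.
  small-scale : ∃[ h ] (0ℚ < h × h < 1ℚ ×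
                        (1ℚ + h) * (1ℚ + ι m * h) ≤ (1ℚ + η) * (1ℚ - (h + h)))
  small-scale = h , 0<* (0<1/suc (suc m)) 0<g , ≤-<-trans h≤g g<1 ,
    ≤-trans (0≤⇒*-monoʳ-≤ (1ℚ + ι m * h) (0≤1+ (0≤* (0≤ι m) 0≤h)) (+-monoʳ-≤ 1ℚ h≤g))
    (≤-trans (0≤⇒*-monoˡ-≤ (1ℚ + g) (0≤1+ (<⇒≤ 0<g)) (+-monoʳ-≤ 1ℚ (ι*h≤g m (ℕ.≤-trans (ℕ.n≤1+n m) (ℕ.n≤1+n (suc m))))))
    (≤-trans [1+g]²
      (0≤⇒*-monoˡ-≤ (1ℚ + η) (0≤1+ (<⇒≤ 0<η)) (+-monoʳ-≤ 1ℚ (neg-antimono-≤ 2h≤g)))))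
    where
    0≤h : 0ℚ ≤ h
    0≤h = <⇒≤ (0<* (0<1/suc (suc m)) 0<g)

-- Termwise upper bounds on the spanning ratio.

foldr-⊓-≤ : ∀ s {x xs} n → x ∈ xs → seq (foldr _⊓ℝ_ s xs) n ≤ seq x n
foldr-⊓-≤ s {xs = y ∷ ys} n (here refl) = p⊓q≤p (seq y n) (seq (foldr _⊓ℝ_ s ys) n)
foldr-⊓-≤ s {xs = y ∷ ys} n (there x∈)  =
  ≤-trans (p⊓q≤q (seq y n) (seq (foldr _⊓ℝ_ s ys) n)) (foldr-⊓-≤ s n x∈)

Eventually : (ℕ → Set) → Set
Eventually P = ∃[ N ] (∀ n → N ℕ.≤ n → P n)

-- Stronger than `x ≤ℝ fromℚ B`, as no ε is lost, and easily passed through finite maxima.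
EventuallyBelow : ℚ → ℝ → Set
EventuallyBelow B x = Eventually (λ n → seq x n ≤ B)

foldr-⊔-below : ∀ {B} → 0ℚ ≤ B → ∀ {xs} → All (EventuallyBelow B) xs →
                EventuallyBelow B (foldr _⊔ℝ_ 0ℝ xs)
foldr-⊔-below 0≤B [] = 0 , λ _ _ → 0≤B
foldr-⊔-below 0≤B ((M , below) ∷ rest) =
  let N , belows = foldr-⊔-below 0≤B rest
  in M ℕ.⊔ N , λ n M⊔N≤n →
     ⊔-lub (below n (ℕ.≤-trans (ℕ.m≤m⊔n M N) M⊔N≤n)) (belows n (ℕ.≤-trans (ℕ.m≤n⊔m M N) M⊔N≤n))

-- `recip` inverts max(δ, yₙ), which is at least yₙ, so for B ≥ 0 the bound passes to the quotient
-- at the same index n.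
*-recip-≤ : ∀ x y (0<y : 0ℝ <ℝ y) {B} n → 0ℚ ≤ B → seq x n ≤ B * seq y n → seq (x *ℝ recip y 0<y) n ≤ B
*-recip-≤ x y (δ , 0<δ , _) {B} n 0≤B x≤By = subst (seq x n * 1/d ≤_)
  (trans (*-assoc B d 1/d) (trans (cong (B *_) (*-inverseʳ d {{>-nonZero 0<d}})) (*-identityʳ B)))
  (0≤⇒*-monoʳ-≤ 1/d (<⇒≤ (0<1/ 0<d)) (≤-trans x≤By (0≤⇒*-monoˡ-≤ B 0≤B (p≤q⊔p δ (seq y n)))))
  where
  d = δ ⊔ seq y n
  0<d : 0ℚ < d
  0<d = <-≤-trans 0<δ (p≤p⊔q δ (seq y n))
  1/d = (1/ d) {{>-nonZero 0<d}}

module _ {G : Graph} (Γ : Drawing G) (conn : Connected G) where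
  open Graph G

  π-≤ : ∀ {u v vs} n → IsPath G u v vs → seq (π Γ conn u v) n ≤ seq (pathLength Γ vs) n
  π-≤ n path = foldr-⊓-≤ _ n (∈-map⁺ (pathLength Γ) (paths-complete G path))

  -- With an opened `point` this type would not match that of `ratio` syntactically,
  -- and comparing the two would unfold the square roots.
  data Stretch : ℝ → Set where
    stretch : ∀ {u v} (u≢v : u ≢ v) → Stretch
      (π Γ conn u v *ℝ recip (dist (Drawing.point Γ u) (Drawing.point Γ v))
        (dist-positive (Drawing.point Γ u) (Drawing.point Γ v) (Drawing.distinct Γ u≢v)))

  ratio-stretch : ∀ u v → All Stretch (ratio Γ conn u v)
  ratio-stretch u v with u Fin.≟ v
  ... | yes _  = []
  ... | no u≢v = stretch u≢v ∷ []

  ratios-stretch : All Stretch (ratios Γ conn)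
  ratios-stretch = All.concat⁺ (All.map⁺ (All.universal (λ u →
    All.concat⁺ (All.map⁺ (All.universal (ratio-stretch u) (allFin order)))) (allFin order)))

  spanningRatio-below : ∀ {B} → 0ℚ ≤ B →
    (∀ {u v} → u ≢ v → Eventually (λ n →
      seq (π Γ conn u v) n ≤ B * seq (dist (Drawing.point Γ u) (Drawing.point Γ v)) n)) →
    EventuallyBelow B (spanningRatio Γ conn)
  spanningRatio-below {B} 0≤B π≤B*dist = foldr-⊔-below 0≤B (All.map stretch-below ratios-stretch)
    where
    stretch-below : ∀ {x} → Stretch x → EventuallyBelow B x
    stretch-below (stretch {u} {v} u≢v) =
      let N , π≤ = π≤B*dist u≢v
      in N , λ n N≤n → *-recip-≤ (π Γ conn u v) (dist (Drawing.point Γ u) (Drawing.point Γ v))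
                         (dist-positive (Drawing.point Γ u) (Drawing.point Γ v) (Drawing.distinct Γ u≢v)) n 0≤B (π≤ n N≤n)

-- Stretch under decaying abscissas, and the theorem.

module _ {h : ℚ} (0<h : 0ℚ < h) (h<1 : h < 1ℚ) where

  private
    0≤h = <⇒≤ 0<h

  gap² : ∀ {p q} → 0ℚ ≤ p → q ≤ h * p → (p - h * p) * (p - h * p) ≤ (p - q) * (p - q)
  gap² {p} {q} 0≤p q≤hp = square-mono-≤
    (0≤q-p (subst (h * p ≤_) (*-identityˡ p) (0≤⇒*-monoʳ-≤ p 0≤p (<⇒≤ h<1))))
    (+-monoʳ-≤ p (neg-antimono-≤ q≤hp))

  -- Here ℓ is a path length, d an approximate distance with error e, and X the larger abscissa. The
  -- chain is ℓ ≤ (1 + h)(1 + mh) X ≤ (1 + η)(1 - 2h) X ≤ (1 + η) d.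
  stretch-bound : ∀ {η} {m k : ℕ} {ℓ d X e} → 0ℚ < η →
                  (1ℚ + h) * (1ℚ + ι m * h) ≤ (1ℚ + η) * (1ℚ - (h + h)) →
                  0ℚ ≤ X → k ℕ.≤ m → e ≤ h * X →
                  ℓ ≤ (1ℚ + h) * X + ι k * ((1ℚ + h) * (h * X)) →
                  X - h * X < d + e → ℓ ≤ (1ℚ + η) * d
  stretch-bound {η} {m} {k} {ℓ} {d} {X} {e} 0<η small 0≤X k≤ e≤hX ℓ≤ <d =
    ≤-trans ℓ≤
    (≤-trans (+-monoʳ-≤ ((1ℚ + h) * X)
      (0≤⇒*-monoʳ-≤ ((1ℚ + h) * (h * X)) (0≤* (0≤1+ 0≤h) (0≤* 0≤h 0≤X)) (ι-mono-≤ k≤)))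
    (≤-trans (subst₂ _≤_
        (solve 3 (λ h m X → (con 1ℚ :+ h) :* (con 1ℚ :+ m :* h) :* X
           := (con 1ℚ :+ h) :* X :+ m :* ((con 1ℚ :+ h) :* (h :* X))) refl h (ι m) X)
        (*-assoc (1ℚ + η) (1ℚ - (h + h)) X)
        (0≤⇒*-monoʳ-≤ X 0≤X small))
      (0≤⇒*-monoˡ-≤ (1ℚ + η) (0≤1+ (<⇒≤ 0<η))
        (subst₂ _≤_
          (solve 2 (λ h X → X :- h :* X :- h :* X := (con 1ℚ :- (h :+ h)) :* X) refl h X)
          (solve 2 (λ d e → d :+ e :- e := d) refl d (h * X))
          (+-monoˡ-≤ (- (h * X)) (≤-trans (<⇒≤ <d) (+-monoʳ-≤ d e≤hX)))))))


  module _ {G : Graph} (conn : Connected G) {η : ℚ} (0<η : 0ℚ < η)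
           (small : (1ℚ + h) * (1ℚ + ι (Graph.order G) * h) ≤ (1ℚ + η) * (1ℚ - (h + h)))
           (x : Graph.Vertex G → ℚ) (0<x : ∀ v → 0ℚ < x v) (x≤h : ∀ v → x v ≤ h)
           (path : ∀ {u v} → u ≢ v → Leaves G (Decays h x) u v ⊎ Arrives G (Decays h x) u v) where
    open Graph G

    private
      0≤x : ∀ v → 0ℚ ≤ x v
      0≤x v = <⇒≤ (0<x v)

      hx<x : ∀ v → h * x v < x v
      hx<x v = subst (h * x v <_) (*-identityˡ (x v)) (*-monoˡ-<-pos (x v) {{positive (0<x v)}} h<1)

      -- One of the two abscissas is at most h < 1 times the other, which is positive.
      x-injective : ∀ {u v} → u ≢ v → x u ≢ x v
      x-injective {u} {v} u≢v xu≡xv with path u≢v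
      ... | inj₁ (_ , _ , dec , _) = <-irrefl (sym xu≡xv) (≤-<-trans dec (hx<x u))
      ... | inj₂ (_ , _ , dec , _) = <-irrefl xu≡xv (≤-<-trans dec (hx<x v))

      Γ : Drawing G
      Γ = parabolaDrawing x x-injective

      Near : Vertex → Vertex → Set
      Near u v = Eventually (λ n →
        seq (π Γ conn u v) n ≤ (1ℚ + η) * seq (dist (Drawing.point Γ u) (Drawing.point Γ v)) n)

      <-point-dist : ∀ u v {a} n → a * a ≤ (x u - x v) * (x u - x v) →
                     a < seq (dist (Drawing.point Γ u) (Drawing.point Γ v)) n + 1/suc n
      <-point-dist u v {a} n a²≤ = subst (λ d → a < seq d n + 1/suc n)
        (point-dist {G} x x-injective u v) (<-dist (x u) (x v) n a²≤)

      near-leaves : ∀ {u v} → Leaves G (Decays h x) u v → Near u v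
      near-leaves {u} {v} (vs , p@(_ , _ , _ , uniq) , dec , decs) =
        -- From `N` on, the error 1/(n + 1) of the distance is at most h · `x u`, as `stretch-bound`
        -- requires.
        let N , tiny = 1/suc-small (0<* 0<h (0<x u))
        in N , λ n N≤n → stretch-bound
             {d = seq (dist (Drawing.point Γ u) (Drawing.point Γ v)) n} 0<η small (0≤x u)
             (ℕ.≤-trans (ℕ.n≤1+n (length vs)) (unique⇒length≤order G uniq)) (tiny n N≤n)
             (≤-trans (π-≤ Γ conn n p)
               (pathLength-∷-≤ x x-injective 0≤h 0≤x n (x≤h u) (<⇒≤ (hx<x u)) u vs ≤-refl decs))
             (<-point-dist u v n (gap² {x u} {x v} (0≤x u) dec))

      -- Mirror image of `near-leaves`: the abscissa of `v` takes the role of X, and `square-swap`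
      -- reverses the difference.
      near-arrives : ∀ {u v} → Arrives G (Decays h x) u v → Near u v
      near-arrives {u} {v} (vs , p@(_ , _ , _ , uniq) , dec , decs) =
        let N , tiny = 1/suc-small (0<* 0<h (0<x v))
        in N , λ n N≤n → stretch-bound
             {d = seq (dist (Drawing.point Γ u) (Drawing.point Γ v)) n} 0<η small (0≤x v)
             (ℕ.≤-trans (length-++-≤ˡ vs) (unique⇒length≤order G uniq)) (tiny n N≤n)
             (≤-trans (π-≤ Γ conn n p)
               (pathLength-∷ʳ-≤ x x-injective 0≤h 0≤x n (x≤h v) (<⇒≤ (hx<x v)) vs v decs ≤-refl))
             (<-point-dist u v n (subst ((x v - h * x v) * (x v - h * x v) ≤_)
               (square-swap (x u) (x v)) (gap² {x v} {x u} (0≤x v) dec)))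

    decaying-drawing : Σ[ Γ ∈ Drawing G ] (Proper Γ × EventuallyBelow (1ℚ + η) (spanningRatio Γ conn))
    decaying-drawing = Γ , parabolaDrawing-proper {G} x x-injective ,
      spanningRatio-below Γ conn (0≤1+ (<⇒≤ 0<η)) (λ u≢v → [ near-leaves , near-arrives ]′ (path u≢v))

low-stretch-drawing : ∀ {η} → 0ℚ < η → (G : Graph) (conn : Connected G) →
  Σ[ Γ ∈ Drawing G ] (Proper Γ × EventuallyBelow (1ℚ + η) (spanningRatio Γ conn))
low-stretch-drawing 0<η G conn =
  let h , 0<h , h<1 , small = small-scale 0<η (Graph.order G)
      h≤1 = <⇒≤ h<1
      L , grown , all = connected-order G conn
  in decaying-drawing 0<h h<1 conn 0<η small (geometric h L)
       (geometric-positive h 0<h h≤1 L) (geometric-≤ h 0<h h≤1 L)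
       (λ {u} {v} → dominated-path G grown
         (geometric-decays h 0<h h≤1 (grown-unique G grown)) (all u) (all v))

theorem5 : ∀ (ε : ℝ) → 0ℝ <ℝ ε → ∀ (G : Graph) (conn : Connected G) →
    Σ[ Γ ∈ Drawing G ] (Proper Γ × spanningRatio Γ conn <ℝ 1ℝ +ℝ ε)
theorem5 ε (δ , 0<δ , M , δ≤ε) G conn =
  -- One half of δ bounds the excess of the ratio over 1; the other is the positive gap that `<ℝ`
  -- demands.
  let η = ½ * δ
      0<η = 0<½* 0<δ
      Γ , proper , N , below = low-stretch-drawing 0<η G conn
  in Γ , proper , η , 0<η , M ℕ.⊔ N , λ n M⊔N≤n →
       ≤-trans (+-monoˡ-≤ η (below n (ℕ.≤-trans (ℕ.m≤n⊔m M N) M⊔N≤n)))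
         (subst (_≤ 1ℚ + seq ε n)
           (trans (cong (1ℚ +_) (trans (+-identityˡ δ) (sym (½+½ δ)))) (sym (+-assoc 1ℚ η η)))
           (+-monoʳ-≤ 1ℚ (δ≤ε n (ℕ.≤-trans (ℕ.m≤m⊔n M N) M⊔N≤n))))
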